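{- Let $a,b,n$ be positive integers with $1\le a<b$, and let $G$ be a finite simple graph with minimum degree $\delta(G)\geq a+n$ and isolated toughness $I(G)\geq a-1+\frac{a+2n-1}{b}$. Then for every matching $M$ of $G$ with $|M|=n$, the graph $G-M$ has an $[a,b]$-factor.
   Context: For a graph $G$ and $S\subseteq V(G)$, $i(G-S)$ denotes the number of isolated vertices of $G-S$. The isolated toughness of $G$ is $I(G)=\min\{|S|/i(G-S): S\subseteq V(G),\ i(G-S)\geq 2\}$ if $G$ is not complete, and $I(G)=|V(G)|-1$ if $G$ is complete. A spanning subgraph $H$ of $G$ is an $[a,b]$-factor if $a\le d_H(x)\le b$ for every $x\in V(G)$. $G-M$ denotes the graph obtained by deleting the edges of $M$ (keeping all vertices). -}

module Defs where

open import Data.Nat using (ℕ; zero; suc; _+_; _*_; _∸_; _≤_)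
open import Data.Bool using (Bool; true; false; if_then_else_; _∧_; _∨_; not)
open import Data.Fin using (Fin)
open import Data.List using (List; []; _∷_; length; concatMap; map; allFin)
open import Data.Nat.ListAction using (sum)
open import Data.Bool.ListAction using (any; all)
open import Relation.Nullary using (¬_)
open import Data.Product using (Σ)
open import Data.List.Relation.Unary.All using (All)
open import Data.List.Relation.Unary.Unique.Propositional using (Unique)
open import Data.Product using (_×_; _,_; proj₁; proj₂)
open import Data.Fin.Properties using (_≟_)
open import Relation.Nullary.Decidable using (⌊_⌋)
open import Relation.Binary.PropositionalEquality using (_≡_)

record Graph (N : ℕ) : Set where
  field
    adj   : Fin N → Fin N → Bool
    sym   : ∀ u v → adj u v ≡ adj v u
    irrefl : ∀ v → adj v v ≡ false
open Graph public

count : ∀ {N} → (Fin N → Bool) → ℕ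
count {N} P = sum (map (λ v → if P v then 1 else 0) (allFin N))

deg : ∀ {N} → (Fin N → Fin N → Bool) → Fin N → ℕ
deg E x = count (E x)

MinDegreeAtLeast : ∀ {N} → Graph N → ℕ → Set
MinDegreeAtLeast G k = ∀ x → k ≤ deg (adj G) x

Complete : ∀ {N} → Graph N → Set
Complete G = ∀ u v → ¬ (u ≡ v) → adj G u v ≡ true

isolatedIn : ∀ {N} → Graph N → (Fin N → Bool) → Fin N → Bool
isolatedIn {N} G S x = not (S x) ∧ all (λ u → not (adj G x u) ∨ S u) (allFin N)

iso : ∀ {N} → Graph N → (Fin N → Bool) → ℕ
iso G S = count (isolatedIn G S)

-- I(G) ≥ p / q  (q > 0), unfolding the definition of isolated toughness:
-- if G is complete, I(G) = |V(G)| - 1; otherwise I(G) is the minimum of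
-- |S| / i(G-S) over all S with i(G-S) ≥ 2 (cross-multiplied, no rationals).
IsoToughnessAtLeast : ∀ {N} → Graph N → ℕ → ℕ → Set
IsoToughnessAtLeast {N} G p q =
  (Complete G → p ≤ q * (N ∸ 1)) ×
  (¬ Complete G → ∀ (S : Fin N → Bool) → 2 ≤ iso G S → p * iso G S ≤ q * count S)

endpoints : ∀ {N} → List (Fin N × Fin N) → List (Fin N)
endpoints = concatMap (λ e → proj₁ e ∷ proj₂ e ∷ [])

-- M is a matching of G: every listed pair is an edge of G, and no vertex
-- is an endpoint twice (so edges are distinct and pairwise disjoint);
-- |M| = length M.
IsMatching : ∀ {N} → Graph N → List (Fin N × Fin N) → Set
IsMatching G M = All (λ e → adj G (proj₁ e) (proj₂ e) ≡ true) M × Unique (endpoints M)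

inM : ∀ {N} → List (Fin N × Fin N) → Fin N → Fin N → Bool
inM M u v = any (λ e → (⌊ proj₁ e ≟ u ⌋ ∧ ⌊ proj₂ e ≟ v ⌋) ∨ (⌊ proj₁ e ≟ v ⌋ ∧ ⌊ proj₂ e ≟ u ⌋)) M

minusEdges : ∀ {N} → Graph N → List (Fin N × Fin N) → Fin N → Fin N → Bool
minusEdges G M u v = adj G u v ∧ not (inM M u v)

IsFactor : ∀ {N} → (Fin N → Fin N → Bool) → ℕ → ℕ → (Fin N → Fin N → Bool) → Set
IsFactor E a b H =
  (∀ u v → H u v ≡ H v u) ×
  (∀ u v → H u v ≡ true → E u v ≡ true) ×
  (∀ x → a ≤ deg H x × deg H x ≤ b)

HasFactor : ∀ {N} → (Fin N → Fin N → Bool) → ℕ → ℕ → Set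
HasFactor {N} E a b = Σ (Fin N → Fin N → Bool) (IsFactor E a b)

{-# OPTIONS --safe #-}
module Submission where

-- Lovász's criterion for a < b: either E has an [a,b]-factor, or there are disjoint S, T with
-- b|S| + ∑_T d_{E−S} < a|T|.  A subgraph H with degrees at most b is improved along walks from a
-- vertex of degree below a that alternate between E ∖ H and H, and if no such walk can end, the
-- vertices from which none can end form S and T.  Because a < b, no vertex lies in both, so there
-- is no parity obstruction.
--
-- For E = G − M, restoring the edges of M costs at most 2n: with d = d_{G−S}, b|S| is less than
-- 2n + ∑_T (a ∸ d).  Choosing vertices of T greedily by least d gives an independent set I with
-- ∑_T (a ∸ d) ≤ ∑_I (d + 1)(a ∸ d).  Deleting S ∪ N(I) isolates I, and
-- (d + 1)(a − d) + b d ≤ a + b(a − 1) for d < a, so |I| ≥ 2 contradicts the isolated toughness;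
-- |I| ≤ 1 contradicts the minimum degree.

open import Defs renaming (sym to adj-sym; irrefl to adj-irrefl)
open import Algebra.Properties.CommutativeSemigroup using (interchange)
open import Data.Nat using (ℕ; zero; suc; _+_; _*_; _∸_; _≤_; _<_; z≤n; s≤s)
open import Data.Nat.Properties hiding (_≟_)
open import Data.Nat.ListAction using (sum)
open import Data.Bool using (Bool; true; false; if_then_else_; _∧_; _∨_; not)
open import Data.Bool.ListAction using (all)
open import Data.Bool.Properties using (∨-comm; ∧-identityʳ; ¬-not) renaming (_≟_ to _≟ᵇ_)
open import Data.Nat.Tactic.RingSolver using (solve-∀)
open import Data.Fin using (Fin)
open import Data.Fin.Properties using (_≟_; any?)
open import Data.List using (List; []; _∷_; length; map; allFin)
open import Data.List.Membership.Propositional using (_∈_)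
open import Data.List.Membership.Propositional.Properties using (∈-allFin)
open import Data.List.Relation.Unary.All as All using (All; []; _∷_)
open import Data.List.Relation.Unary.Any using (here; there)
open import Data.List.Relation.Unary.AllPairs using ([]; _∷_)
open import Data.List.Relation.Unary.Unique.Propositional using (Unique)
open import Data.List.Relation.Unary.Unique.Propositional.Properties using (allFin⁺)
open import Data.Product using (_×_; _,_; proj₁; proj₂; ∃₂; ∃-syntax)
open import Data.Sum using (_⊎_; inj₁; inj₂)
open import Data.Empty using (⊥; ⊥-elim)
open import Function using (_∘_)
open import Relation.Nullary using (¬_; Dec; yes; no; contradiction)
open import Relation.Nullary.Decidable using (⌊_⌋; _×-dec_; _⊎-dec_; ¬?)
open import Relation.Binary.PropositionalEquality
  using (_≡_; _≢_; refl; sym; trans; cong; cong₂; subst)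

private
  variable
    A B : Set
    N : ℕ

-- Finite sums over vertices and Boolean indicators.

⟦_⟧ : Bool → ℕ
⟦ p ⟧ = if p then 1 else 0

-- count P is definitionally ∑ (⟦_⟧ ∘ P).
∑ : (Fin N → ℕ) → ℕ
∑ {N} f = sum (map f (allFin N))

δ : Fin N → Fin N → ℕ
δ x v = ⟦ ⌊ x ≟ v ⌋ ⟧

δ-refl : (x : Fin N) → δ x x ≡ 1
δ-refl x with x ≟ x
... | yes _ = refl
... | no x≢x = contradiction refl x≢x

δ-≢ : {x v : Fin N} → x ≢ v → δ x v ≡ 0
δ-≢ {x = x} {v} x≢v with x ≟ v
... | yes x≡v = contradiction x≡v x≢v
... | no _ = refl

sum-map-mono : {f g : A → ℕ} → (∀ v → f v ≤ g v) → ∀ xs → sum (map f xs) ≤ sum (map g xs)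
sum-map-mono f≤g [] = z≤n
sum-map-mono f≤g (x ∷ xs) = +-mono-≤ (f≤g x) (sum-map-mono f≤g xs)

sum-map-mono-< : {f g : A → ℕ} → (∀ v → f v ≤ g v) → ∀ {i xs} → i ∈ xs → f i < g i →
  sum (map f xs) < sum (map g xs)
sum-map-mono-< f≤g {xs = _ ∷ xs} (here refl) fi<gi = +-mono-<-≤ fi<gi (sum-map-mono f≤g xs)
sum-map-mono-< f≤g {xs = x ∷ _} (there i∈xs) fi<gi = +-mono-≤-< (f≤g x) (sum-map-mono-< f≤g i∈xs fi<gi)

sum-map-+ : (f g : A → ℕ) → ∀ xs → sum (map (λ v → f v + g v) xs) ≡ sum (map f xs) + sum (map g xs)
sum-map-+ f g [] = refl
sum-map-+ f g (x ∷ xs) = trans (cong (f x + g x +_) (sum-map-+ f g xs)) (interchange +-commutativeSemigroup (f x) (g x) _ _)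

sum-map-*ˡ : ∀ c (f : A → ℕ) xs → sum (map (λ v → c * f v) xs) ≡ c * sum (map f xs)
sum-map-*ˡ c f [] = sym (*-zeroʳ c)
sum-map-*ˡ c f (x ∷ xs) = trans (cong (c * f x +_) (sum-map-*ˡ c f xs)) (sym (*-distribˡ-+ c (f x) _))

sum-map-swap : (f : A → B → ℕ) → ∀ xs ys →
  sum (map (λ u → sum (map (f u) ys)) xs) ≡ sum (map (λ v → sum (map (λ u → f u v) xs)) ys)
sum-map-swap f [] [] = refl
sum-map-swap f [] (y ∷ ys) = sum-map-swap f [] ys
sum-map-swap f (x ∷ xs) ys =
  trans (cong (sum (map (f x) ys) +_) (sum-map-swap f xs ys)) (sym (sum-map-+ (f x) _ ys))

∑-mono : {f g : Fin N → ℕ} → (∀ v → f v ≤ g v) → ∑ f ≤ ∑ g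
∑-mono f≤g = sum-map-mono f≤g (allFin _)

∑-cong : {f g : Fin N → ℕ} → (∀ v → f v ≡ g v) → ∑ f ≡ ∑ g
∑-cong f≡g = ≤-antisym (∑-mono (≤-reflexive ∘ f≡g)) (∑-mono (≤-reflexive ∘ sym ∘ f≡g))

∑-mono-< : {f g : Fin N → ℕ} → (∀ v → f v ≤ g v) → ∀ i → f i < g i → ∑ f < ∑ g
∑-mono-< f≤g i = sum-map-mono-< f≤g (∈-allFin i)

∑-+ : (f g : Fin N → ℕ) → ∑ (λ v → f v + g v) ≡ ∑ f + ∑ g
∑-+ f g = sum-map-+ f g (allFin _)

∑-*ˡ : ∀ c (f : Fin N → ℕ) → ∑ (λ v → c * f v) ≡ c * ∑ f
∑-*ˡ c f = sum-map-*ˡ c f (allFin _)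

∑-swap : (f : Fin N → Fin N → ℕ) → ∑ (λ u → ∑ (f u)) ≡ ∑ (λ v → ∑ (λ u → f u v))
∑-swap f = sum-map-swap f (allFin _) (allFin _)

occurrences : Fin N → List (Fin N) → ℕ
occurrences u xs = sum (map (λ x → δ x u) xs)

occurrences-∉ : {u : Fin N} → ∀ {xs} → All (_≢ u) xs → occurrences u xs ≡ 0
occurrences-∉ [] = refl
occurrences-∉ (x≢u ∷ u∉xs) = cong₂ _+_ (δ-≢ x≢u) (occurrences-∉ u∉xs)

occurrences-∈ : {u : Fin N} → ∀ {xs} → u ∈ xs → 1 ≤ occurrences u xs
occurrences-∈ {u = u} (here refl) = ≤-trans (≤-reflexive (sym (δ-refl u))) (m≤m+n _ _)
occurrences-∈ (there u∈xs) = ≤-trans (occurrences-∈ u∈xs) (m≤n+m _ _)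

-- This serves twice: on `allFin` it gives `∑-δ`, and on the endpoints of a matching it bounds the
-- degree of the matching at each vertex by one.
occurrences-unique : (u : Fin N) → ∀ {xs} → Unique xs → occurrences u xs ≤ 1
occurrences-unique u [] = z≤n
occurrences-unique u {x ∷ xs} (x∉xs ∷ xs!) with x ≟ u
... | yes refl = ≤-reflexive (cong suc (occurrences-∉ (All.map (_∘ sym) x∉xs)))
... | no _ = occurrences-unique u xs!

δ-sym : (x v : Fin N) → δ x v ≡ δ v x
δ-sym x v with x ≟ v
... | yes refl = sym (δ-refl x)
... | no x≢v = sym (δ-≢ (x≢v ∘ sym))

∑-δ : (x : Fin N) → ∑ (δ x) ≡ 1
∑-δ {N} x = trans (∑-cong (δ-sym x))
  (≤-antisym (occurrences-unique x (allFin⁺ N)) (occurrences-∈ (∈-allFin x)))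

∑-δ* : (x : Fin N) (f : Fin N → ℕ) → ∑ (λ v → δ x v * f v) ≡ f x
∑-δ* x f = trans (∑-cong localise) (trans (∑-*ˡ (f x) (δ x)) (trans (cong (f x *_) (∑-δ x)) (*-identityʳ (f x))))
  where
  localise : ∀ v → δ x v * f v ≡ f x * δ x v
  localise v with x ≟ v
  ... | yes refl = *-comm 1 (f x)
  ... | no _ = sym (*-zeroʳ (f x))

∑-0 : ∑ {N} (λ _ → 0) ≡ 0
∑-0 {N} = ∑-*ˡ {N} 0 (λ _ → 0)

term≤∑ : (f : Fin N → ℕ) → ∀ i → f i ≤ ∑ f
term≤∑ f i = ≤-trans (≤-reflexive (sym (∑-δ* i f))) (∑-mono λ v → δ*≤ v)
  where
  δ*≤ : ∀ v → δ i v * f v ≤ f v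
  δ*≤ v with i ≟ v
  ... | yes _ = ≤-reflexive (+-identityʳ (f v))
  ... | no _ = z≤n

-- Vertex sets as Boolean predicates.

infixl 6 _∖_
_∖_ : (Fin N → Bool) → (Fin N → Bool) → Fin N → Bool
(P ∖ Q) v = P v ∧ not (Q v)

∖-elim : ∀ (P Q : Fin N → Bool) {v} → (P ∖ Q) v ≡ true → P v ≡ true × Q v ≡ false
∖-elim P Q {v} r with P v | Q v
... | true | false = refl , refl

count-∖ : ∀ {y} (P Q : Fin N → Bool) → P y ≡ true → Q y ≡ true → count (P ∖ Q) < count P
count-∖ {y = y} P Q Py Qy = ∑-mono-< smaller y strict
  where
  smaller : ∀ v → ⟦ (P ∖ Q) v ⟧ ≤ ⟦ P v ⟧
  smaller v with P v | Q v
  ... | true | true = z≤n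
  ... | true | false = ≤-refl
  ... | false | _ = z≤n
  strict : ⟦ (P ∖ Q) y ⟧ < ⟦ P y ⟧
  strict rewrite Py | Qy = s≤s z≤n

count≤count∖+count : (P Q : Fin N → Bool) → count P ≤ count (P ∖ Q) + count Q
count≤count∖+count P Q = ≤-trans (∑-mono covered) (≤-reflexive (∑-+ (⟦_⟧ ∘ (P ∖ Q)) (⟦_⟧ ∘ Q)))
  where
  covered : ∀ v → ⟦ P v ⟧ ≤ ⟦ (P ∖ Q) v ⟧ + ⟦ Q v ⟧
  covered v with P v | Q v
  ... | true | true = ≤-refl
  ... | true | false = ≤-refl
  ... | false | _ = z≤n

⁅_⁆ : Fin N → Fin N → Bool
⁅ x ⁆ v = ⌊ x ≟ v ⌋

x∈⁅x⁆ : (x : Fin N) → ⁅ x ⁆ x ≡ true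
x∈⁅x⁆ x with x ≟ x
... | yes _ = refl
... | no x≢x = contradiction refl x≢x

∈⁅⁆⇒≡ : {x v : Fin N} → ⁅ x ⁆ v ≡ true → x ≡ v
∈⁅⁆⇒≡ {x = x} {v} r with x ≟ v
... | yes x≡v = x≡v

∖⁅⁆-false : ∀ {y v} (P : Fin N → Bool) → (P ∖ ⁅ y ⁆) v ≡ false → y ≡ v ⊎ P v ≡ false
∖⁅⁆-false {y = y} {v} P r with P v | y ≟ v
... | false | _ = inj₂ refl
... | true | yes y≡v = inj₁ y≡v

-- d_{E−S}(y), defined also for y in S.
deg∖ : (Fin N → Fin N → Bool) → (Fin N → Bool) → Fin N → ℕ
deg∖ E S y = count (E y ∖ S)

-- Lovász's obstruction to an [a,b]-factor; for a < b it is the only one.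
Deficient : (Fin N → Fin N → Bool) → ℕ → ℕ → (Fin N → Bool) → (Fin N → Bool) → Set
Deficient E a b S T =
  (∀ y → T y ≡ true → S y ≡ false) ×
  b * count S + ∑ (λ y → ⟦ T y ⟧ * deg∖ E S y) < a * count T

-- Degrees after inserting or deleting one edge.

link : Fin N → Fin N → Fin N → Fin N → Bool
link x w u v = (⌊ x ≟ u ⌋ ∧ ⌊ w ≟ v ⌋) ∨ (⌊ x ≟ v ⌋ ∧ ⌊ w ≟ u ⌋)

link-elim : ∀ (x w u v : Fin N) → link x w u v ≡ true → (x ≡ u × w ≡ v) ⊎ (x ≡ v × w ≡ u)
link-elim x w u v with x ≟ u | w ≟ v | x ≟ v | w ≟ u
... | yes p | yes q | _ | _ = λ _ → inj₁ (p , q)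
... | yes _ | no _ | yes p | yes q = λ _ → inj₂ (p , q)
... | no _ | _ | yes p | yes q = λ _ → inj₂ (p , q)
... | yes _ | no _ | yes _ | no _ = λ ()
... | yes _ | no _ | no _ | _ = λ ()
... | no _ | _ | yes _ | no _ = λ ()
... | no _ | _ | no _ | _ = λ ()

link-sym : ∀ (x w u v : Fin N) → link x w u v ≡ link x w v u
link-sym x w u v = ∨-comm (⌊ x ≟ u ⌋ ∧ ⌊ w ≟ v ⌋) (⌊ x ≟ v ⌋ ∧ ⌊ w ≟ u ⌋)

link-≢ : ∀ {x w u : Fin N} v → u ≢ x → u ≢ w → link x w u v ≡ false
link-≢ {x = x} {w} {u} v u≢x u≢w = ¬-not λ l → absurd (link-elim x w u v l)
  where
  absurd : (x ≡ u × w ≡ v) ⊎ (x ≡ v × w ≡ u) → ⊥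
  absurd (inj₁ (x≡u , _)) = u≢x (sym x≡u)
  absurd (inj₂ (_ , w≡u)) = u≢w (sym w≡u)

⟦∨⟧≤ : ∀ p q → ⟦ p ∨ q ⟧ ≤ ⟦ p ⟧ + ⟦ q ⟧
⟦∨⟧≤ true q = s≤s z≤n
⟦∨⟧≤ false q = ≤-refl

⟦∨⟧-disjoint : ∀ p q → (q ≡ true → p ≡ false) → ⟦ p ∨ q ⟧ ≡ ⟦ p ⟧ + ⟦ q ⟧
⟦∨⟧-disjoint false q _ = refl
⟦∨⟧-disjoint true false _ = refl
⟦∨⟧-disjoint true true disjoint with () ← disjoint refl

⟦∧⟧ : ∀ p q → ⟦ p ∧ q ⟧ ≡ ⟦ p ⟧ * ⟦ q ⟧
⟦∧⟧ true q = sym (+-identityʳ ⟦ q ⟧)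
⟦∧⟧ false q = refl

⟦∧not⟧ : ∀ p q → (q ≡ true → p ≡ true) → ⟦ p ∧ not q ⟧ + ⟦ q ⟧ ≡ ⟦ p ⟧
⟦∧not⟧ true true _ = refl
⟦∧not⟧ true false _ = refl
⟦∧not⟧ false false _ = refl
⟦∧not⟧ false true q⇒p with () ← q⇒p refl

private
  ∑-ends : ∀ (x w u : Fin N) → ∑ (λ v → ⟦ ⌊ x ≟ u ⌋ ∧ ⌊ w ≟ v ⌋ ⟧ + ⟦ ⌊ x ≟ v ⌋ ∧ ⌊ w ≟ u ⌋ ⟧) ≡ δ x u + δ w u
  ∑-ends x w u = trans (∑-cong λ v → cong₂ _+_ (trans (⟦∧⟧ ⌊ x ≟ u ⌋ ⌊ w ≟ v ⌋) (*-comm (δ x u) (δ w v)))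
                                               (⟦∧⟧ ⌊ x ≟ v ⌋ ⌊ w ≟ u ⌋))
    (trans (∑-+ (λ v → δ w v * δ x u) (λ v → δ x v * δ w u)) (cong₂ _+_ (∑-δ* w (λ _ → δ x u)) (∑-δ* x (λ _ → δ w u))))

deg-link≤ : ∀ (x w u : Fin N) → deg (link x w) u ≤ δ x u + δ w u
deg-link≤ x w u = ≤-trans (∑-mono λ v → ⟦∨⟧≤ _ (⌊ x ≟ v ⌋ ∧ ⌊ w ≟ u ⌋)) (≤-reflexive (∑-ends x w u))

-- Equality needs distinct ends: for a loop the two orientations are the same pair, counted once on
-- the left and twice on the right.
deg-link : ∀ {x w : Fin N} → x ≢ w → ∀ u → deg (link x w) u ≡ δ x u + δ w u
deg-link {x = x} {w} x≢w u = trans (∑-cong λ v → ⟦∨⟧-disjoint _ _ (disjoint v)) (∑-ends x w u)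
  where
  disjoint : ∀ v → ⌊ x ≟ v ⌋ ∧ ⌊ w ≟ u ⌋ ≡ true → ⌊ x ≟ u ⌋ ∧ ⌊ w ≟ v ⌋ ≡ false
  disjoint v _ with x ≟ u
  ... | no _ = refl
  disjoint v _ | yes refl with x ≟ v | w ≟ x | w ≟ v
  ... | _ | _ | no _ = refl
  ... | _ | yes w≡x | yes _ = contradiction (sym w≡x) x≢w
  disjoint v () | yes refl | yes _ | no _ | yes _
  disjoint v () | yes refl | no _ | no _ | yes _

insert delete : Fin N → Fin N → (Fin N → Fin N → Bool) → Fin N → Fin N → Bool
insert x w H u v = H u v ∨ link x w u v
delete x w H u v = H u v ∧ not (link x w u v)

Symmetric : (Fin N → Fin N → Bool) → Set
Symmetric H = ∀ u v → H u v ≡ H v u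

insert-sym : ∀ (x w : Fin N) {H} → Symmetric H → Symmetric (insert x w H)
insert-sym x w H-sym u v = cong₂ _∨_ (H-sym u v) (link-sym x w u v)

delete-sym : ∀ (x w : Fin N) {H} → Symmetric H → Symmetric (delete x w H)
delete-sym x w H-sym u v = cong₂ (λ p q → p ∧ not q) (H-sym u v) (link-sym x w u v)

link⇒≡ : ∀ (x w : Fin N) {H} → Symmetric H → ∀ u v → link x w u v ≡ true → H u v ≡ H x w
link⇒≡ x w H-sym u v l with link-elim x w u v l
... | inj₁ (refl , refl) = refl
... | inj₂ (refl , refl) = H-sym u v

deg-insert : ∀ {x w : Fin N} {H} → Symmetric H → x ≢ w → H x w ≡ false →
  ∀ u → deg (insert x w H) u ≡ deg H u + (δ x u + δ w u)
deg-insert {x = x} {w} {H} H-sym x≢w ¬Hxw u =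
  trans (∑-cong λ v → ⟦∨⟧-disjoint (H u v) _ λ l → trans (link⇒≡ x w H-sym u v l) ¬Hxw)
    (trans (∑-+ (⟦_⟧ ∘ H u) (⟦_⟧ ∘ link x w u)) (cong (deg H u +_) (deg-link x≢w u)))

deg-delete : ∀ {x w : Fin N} {H} → Symmetric H → x ≢ w → H x w ≡ true →
  ∀ u → deg (delete x w H) u + (δ x u + δ w u) ≡ deg H u
deg-delete {x = x} {w} {H} H-sym x≢w Hxw u =
  trans (cong (deg (delete x w H) u +_) (sym (deg-link x≢w u)))
    (trans (sym (∑-+ (⟦_⟧ ∘ delete x w H u) (⟦_⟧ ∘ link x w u)))
      (∑-cong λ v → ⟦∧not⟧ (H u v) _ λ l → trans (link⇒≡ x w H-sym u v l) Hxw))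

-- Lovász's criterion by alternating walks.

module AlternatingWalks {N} (E : Fin N → Fin N → Bool) (E-sym : Symmetric E) (E-irrefl : ∀ v → E v v ≡ false)
                        (a b : ℕ) (a<b : a < b) where

  -- Walks of length at most k alternating between E ∖ H and H, from a vertex where one more H-edge
  -- (Gain) or one H-edge less (Lose) is wanted, to a vertex which can absorb the change.
  data Gain (H : Fin N → Fin N → Bool) : ℕ → Fin N → Set
  data Lose (H : Fin N → Fin N → Bool) : ℕ → Fin N → Set

  data Gain H where
    stop : ∀ {k y} → a < deg H y → Gain H k y
    step : ∀ {k y u} → E y u ≡ true → H y u ≡ false → Lose H k u → Gain H (suc k) y

  data Lose H where
    stop : ∀ {k y} → deg H y < b → Lose H k y
    step : ∀ {k y u} → H y u ≡ true → Gain H k u → Lose H (suc k) y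

  Gain-weaken : ∀ {H k y} → Gain H k y → Gain H (suc k) y
  Lose-weaken : ∀ {H k y} → Lose H k y → Lose H (suc k) y
  Gain-weaken (stop p) = stop p
  Gain-weaken (step e h l) = step e h (Lose-weaken l)
  Lose-weaken (stop p) = stop p
  Lose-weaken (step h g) = step h (Gain-weaken g)

  record Admissible (H : Fin N → Fin N → Bool) : Set where
    field
      symm  : Symmetric H
      sub   : ∀ u v → H u v ≡ true → E u v ≡ true
      bound : ∀ v → deg H v ≤ b
  open Admissible

  edge⇒≢ : ∀ {u v} → E u v ≡ true → u ≢ v
  edge⇒≢ {u} Euv refl with () ← trans (sym Euv) (E-irrefl u)

  -- The subtraction is truncated, so a degree above `a` at one vertex does not offset a shortage at
  -- another. This is the quantity that decreases in `improve`.
  deficit : (Fin N → Fin N → Bool) → ℕ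
  deficit H = ∑ (λ v → a ∸ deg H v)

  sub-insert : ∀ {H x w} → (∀ u v → H u v ≡ true → E u v ≡ true) → E x w ≡ true →
    ∀ u v → insert x w H u v ≡ true → E u v ≡ true
  sub-insert {H} {x} {w} H⊆E Exw u v i with H u v in Huv
  ... | true = H⊆E u v Huv
  ... | false = trans (link⇒≡ x w E-sym u v i) Exw

  sub-delete : ∀ {H} x w → (∀ u v → H u v ≡ true → E u v ≡ true) →
    ∀ u v → delete x w H u v ≡ true → E u v ≡ true
  sub-delete {H} x w H⊆E u v d with H u v in Huv
  ... | true = H⊆E u v Huv

  -- A walk that stops after its first edge: both ends have room below `b`, the shortage at `x`
  -- drops by one, and no degree falls.
  module Insert {H} (adm : Admissible H) {x w} (x<a : deg H x < a) (Exw : E x w ≡ true) (¬Hxw : H x w ≡ false)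
                (w<b : deg H w < b) where
    private
      x≢w : x ≢ w
      x≢w = edge⇒≢ Exw

      deg′ : ∀ u → deg (insert x w H) u ≡ deg H u + (δ x u + δ w u)
      deg′ = deg-insert (symm adm) x≢w ¬Hxw

    admissible : Admissible (insert x w H)
    admissible .symm = insert-sym x w (symm adm)
    admissible .sub = sub-insert (sub adm) Exw
    admissible .bound v with x ≟ v | w ≟ v | deg′ v
    ... | yes refl | yes refl | _ = contradiction refl x≢w
    ... | yes refl | no _ | eq = ≤-trans (≤-reflexive (trans eq (+-comm _ 1))) (<⇒≤ (<-≤-trans (s≤s x<a) a<b))
    ... | no _ | yes refl | eq = ≤-trans (≤-reflexive (trans eq (+-comm _ 1))) w<b
    ... | no _ | no _ | eq = ≤-trans (≤-reflexive (trans eq (+-identityʳ _))) (bound adm v)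

    deficit-< : deficit (insert x w H) < deficit H
    deficit-< = ∑-mono-< (λ v → ∸-monoʳ-≤ a (≤-trans (m≤m+n (deg H v) _) (≤-reflexive (sym (deg′ v))))) x
      (∸-monoʳ-< (subst (deg H x <_) (sym (deg′ x)) (m<m+n _ (≤-trans (≤-reflexive (sym (δ-refl x))) (m≤m+n _ _))))
                 (subst (_≤ a) (sym eq) x<a))
      where
      eq : deg (insert x w H) x ≡ suc (deg H x)
      eq = trans (deg′ x) (trans (cong (deg H x +_) (cong₂ _+_ (δ-refl x) (δ-≢ (x≢w ∘ sym)))) (+-comm _ 1))

  -- When `w` is full, the edge `xw` is inserted and `wz` is deleted. The degree of `w` is
  -- unchanged, and one unit of degree moves from `z` to `x`.
  module Shift {H} (adm : Admissible H) {x w z} (x<a : deg H x < a) (Exw : E x w ≡ true) (¬Hxw : H x w ≡ false)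
               (b≤w : b ≤ deg H w) (Hwz : H w z ≡ true) where
    H₁ : Fin N → Fin N → Bool
    H₁ = delete w z (insert x w H)

    private
      x≢w : x ≢ w
      x≢w = edge⇒≢ Exw

      w≢z : w ≢ z
      w≢z = edge⇒≢ (sub adm w z Hwz)

      x≢z : x ≢ z
      x≢z refl with () ← trans (sym ¬Hxw) (trans (symm adm x w) Hwz)

    -- The two changes at `w` cancel. Adding on both sides avoids truncated subtraction and treats
    -- all vertices uniformly.
    deg-shift : ∀ v → deg H₁ v + δ z v ≡ deg H v + δ x v
    deg-shift v = +-cancelʳ-≡ (δ w v) _ _ (trans (+-assoc (deg H₁ v) _ _)
      (trans (cong (deg H₁ v +_) (+-comm (δ z v) (δ w v)))
      (trans (deg-delete (insert-sym x w (symm adm)) w≢z (cong (_∨ link x w w z) Hwz) v)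
      (trans (deg-insert (symm adm) x≢w ¬Hxw v) (sym (+-assoc (deg H v) _ _))))))

    deg-≢x : ∀ {v} → v ≢ x → deg H₁ v ≤ deg H v
    deg-≢x {v} v≢x = ≤-trans (m≤m+n _ _) (≤-reflexive
      (trans (deg-shift v) (trans (cong (deg H v +_) (δ-≢ (v≢x ∘ sym))) (+-identityʳ _))))

    deg-≢z : ∀ {v} → v ≢ z → deg H v ≤ deg H₁ v
    deg-≢z {v} v≢z = ≤-trans (m≤m+n _ _) (≤-reflexive
      (trans (sym (deg-shift v)) (trans (cong (deg H₁ v +_) (δ-≢ (v≢z ∘ sym))) (+-identityʳ _))))

    deg-x : deg H₁ x ≡ suc (deg H x)
    deg-x = trans (sym (+-identityʳ _)) (trans (cong (deg H₁ x +_) (sym (δ-≢ (x≢z ∘ sym))))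
      (trans (deg-shift x) (trans (cong (deg H x +_) (δ-refl x)) (+-comm _ 1))))

    deg-z : suc (deg H₁ z) ≡ deg H z
    deg-z = trans (+-comm 1 _) (trans (cong (deg H₁ z +_) (sym (δ-refl z)))
      (trans (deg-shift z) (trans (cong (deg H z +_) (δ-≢ x≢z)) (+-identityʳ _))))

    admissible : Admissible H₁
    admissible .symm = delete-sym w z (insert-sym x w (symm adm))
    admissible .sub = sub-delete w z (sub-insert (sub adm) Exw)
    admissible .bound v with v ≟ x
    ... | yes refl = ≤-trans (≤-reflexive deg-x) (≤-trans x<a (<⇒≤ a<b))
    ... | no v≢x = ≤-trans (deg-≢x v≢x) (bound adm v)

    -- Since `z` starts above `a`, it still has degree at least `a` after losing an edge, so the
    -- gain at `x` is not paid for elsewhere.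
    deficit-< : a < deg H z → deficit H₁ < deficit H
    deficit-< a<z = ∑-mono-< shrinks x
      (∸-monoʳ-< (≤-reflexive (sym deg-x)) (subst (_≤ a) (sym deg-x) x<a))
      where
      shrinks : ∀ v → a ∸ deg H₁ v ≤ a ∸ deg H v
      shrinks v with v ≟ z
      ... | no v≢z = ∸-monoʳ-≤ a (deg-≢z v≢z)
      ... | yes refl = ≤-trans (≤-reflexive (m≤n⇒m∸n≡0 (≤-pred (subst (a <_) (sym deg-z) a<z)))) z≤n

    module _ (z≤a : deg H z ≤ a) where
      -- Here `z` takes over the unit of shortage that `x` sheds. The progress lies in the walk,
      -- whose remainder from `z` is two steps shorter.
      deficit-≡ : deficit H₁ ≡ deficit H
      deficit-≡ = +-cancelʳ-≡ 1 _ _ (begin-equality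
        deficit H₁ + 1                         ≡⟨ cong (deficit H₁ +_) (∑-δ x) ⟨
        deficit H₁ + ∑ (δ x)                   ≡⟨ ∑-+ (λ v → a ∸ deg H₁ v) (δ x) ⟨
        ∑ (λ v → (a ∸ deg H₁ v) + δ x v)       ≡⟨ ∑-cong pointwise ⟩
        ∑ (λ v → (a ∸ deg H v) + δ z v)        ≡⟨ ∑-+ (λ v → a ∸ deg H v) (δ z) ⟩
        deficit H + ∑ (δ z)                    ≡⟨ cong (deficit H +_) (∑-δ z) ⟩
        deficit H + 1                          ∎)
        where
        open ≤-Reasoning
        -- By `deg-shift` the bounded sum also equals `deg H₁ v + δ z v`, so neither subtraction
        -- truncates. The bound holds at `x` because `x` is short, and at `z` by `z≤a`.
        balance : ∀ v → deg H v + δ x v ≤ a → (a ∸ deg H₁ v) + δ x v ≡ (a ∸ deg H v) + δ z v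
        balance v m≤a = +-cancelʳ-≡ (deg H v) _ _ (begin-equality
          (a ∸ deg H₁ v) + δ x v + deg H v       ≡⟨ +-assoc (a ∸ deg H₁ v) _ _ ⟩
          (a ∸ deg H₁ v) + (δ x v + deg H v)     ≡⟨ cong ((a ∸ deg H₁ v) +_) (trans (+-comm (δ x v) _) (sym (deg-shift v))) ⟩
          (a ∸ deg H₁ v) + (deg H₁ v + δ z v)    ≡⟨ +-assoc (a ∸ deg H₁ v) _ _ ⟨
          (a ∸ deg H₁ v) + deg H₁ v + δ z v      ≡⟨ cong (_+ δ z v) (m∸n+n≡m (≤-trans (m≤m+n (deg H₁ v) _) (≤-trans (≤-reflexive (deg-shift v)) m≤a))) ⟩
          a + δ z v                              ≡⟨ cong (_+ δ z v) (m∸n+n≡m (≤-trans (m≤m+n (deg H v) _) m≤a)) ⟨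
          (a ∸ deg H v) + deg H v + δ z v        ≡⟨ +-assoc (a ∸ deg H v) _ _ ⟩
          (a ∸ deg H v) + (deg H v + δ z v)      ≡⟨ cong ((a ∸ deg H v) +_) (+-comm (deg H v) _) ⟩
          (a ∸ deg H v) + (δ z v + deg H v)      ≡⟨ +-assoc (a ∸ deg H v) _ _ ⟨
          (a ∸ deg H v) + δ z v + deg H v        ∎)

        cases : ∀ v → Dec (x ≡ v) → Dec (z ≡ v) → (a ∸ deg H₁ v) + δ x v ≡ (a ∸ deg H v) + δ z v
        cases v (yes refl) _ = balance x (subst (_≤ a) (trans (+-comm 1 _) (cong (deg H x +_) (sym (δ-refl x)))) x<a)
        cases v (no _) (yes refl) = balance z (subst (_≤ a) (trans (sym (+-identityʳ _)) (cong (deg H z +_) (sym (δ-≢ x≢z)))) z≤a)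
        cases v (no x≢v) (no z≢v) = cong₂ (λ d e → (a ∸ d) + e)
          (≤-antisym (deg-≢x (x≢v ∘ sym)) (deg-≢z (z≢v ∘ sym))) (trans (δ-≢ x≢v) (sym (δ-≢ z≢v)))

        pointwise : ∀ v → (a ∸ deg H₁ v) + δ x v ≡ (a ∸ deg H v) + δ z v
        pointwise v = cases v (x ≟ v) (z ≟ v)

      -- A walk meeting one of the two switched edges either can stop there, or revisits x or w in
      -- its old role, which gives a walk from x for the original H without the detour.
      transferGain : ∀ {k y} → Gain H k y → Gain H₁ k y ⊎ Gain H k x
      transferLose : ∀ {k y} → Lose H k y → Lose H₁ k y ⊎ Gain H (suc k) x
      transferGain {y = y} g with y ≟ x | y ≟ w
      ... | yes refl | _ = inj₂ g
      -- In `H₁` the vertex `w` still has degree at least `b`, hence above `a`, and can afford to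
      -- lose an edge.
      ... | no _ | yes refl = inj₁ (stop (<-≤-trans a<b (≤-trans b≤w (deg-≢z w≢z))))
      transferGain (stop {y = y} a<y) | no y≢x | no _ with y ≟ z
      ... | yes refl = contradiction z≤a (<⇒≱ a<y)
      ... | no y≢z = inj₁ (stop (<-≤-trans a<y (deg-≢z y≢z)))
      transferGain (step {y = y} {u} Eyu ¬Hyu l) | no y≢x | no y≢w with transferLose l
      ... | inj₂ g = inj₂ g
      ... | inj₁ l₁ = inj₁ (step Eyu (cong (_∧ not (link w z y u)) (trans (cong (_∨ link x w y u) ¬Hyu) (link-≢ u y≢x y≢w))) l₁)
      transferLose {y = y} l with y ≟ w | y ≟ x | y ≟ z
      -- The rest of the walk starts at `w` in the role that `w` has after the first edge `xw`, so
      -- prefixing that edge gives a walk from `x` in `H`.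
      ... | yes refl | _ | _ = inj₂ (step Exw ¬Hxw l)
      ... | no _ | yes refl | _ = inj₁ (stop (≤-<-trans (subst (_≤ a) (sym deg-x) x<a) a<b))
      ... | no _ | no y≢x | yes refl = inj₁ (stop (≤-<-trans (≤-trans (deg-≢x y≢x) z≤a) a<b))
      transferLose (stop y<b) | no _ | no y≢x | no _ = inj₁ (stop (≤-<-trans (deg-≢x y≢x) y<b))
      transferLose (step {y = y} {u} Hyu g) | no y≢w | no y≢x | no y≢z with transferGain g
      ... | inj₂ g′ = inj₂ (Gain-weaken (Gain-weaken g′))
      ... | inj₁ g₁ = inj₁ (step (cong₂ (λ p q → (p ∨ link x w y u) ∧ not q) Hyu (link-≢ u y≢w y≢z)) g₁)

  -- Induction on the length bound. Unless one switch lowers the deficit, the shift leaves either a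
  -- walk from the newly short vertex `z` in `H₁`, or a shortcut from `x` in the old `H`. Both have
  -- bound `k` in place of `suc (suc k)`.
  augment : ∀ k {H x} → Admissible H → deg H x < a → Gain H k x →
    ∃[ H′ ] Admissible H′ × deficit H′ < deficit H
  augment k adm x<a (stop a<x) = contradiction x<a (<-asym a<x)
  augment (suc k) {H} adm x<a (step {u = w} Exw ¬Hxw l) with deg H w <? b
  ... | yes w<b = _ , Insert.admissible adm x<a Exw ¬Hxw w<b , Insert.deficit-< adm x<a Exw ¬Hxw w<b
  augment (suc k) adm x<a (step Exw ¬Hxw (stop w<b)) | no w≮b = contradiction w<b w≮b
  augment (suc (suc k)) {H} adm x<a (step {u = w} Exw ¬Hxw (step {u = z} Hwz g)) | no w≮b with a <? deg H z
  ... | yes a<z = _ , admissible , deficit-< a<z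
    where open Shift adm x<a Exw ¬Hxw (≮⇒≥ w≮b) Hwz
  ... | no a≮z with Shift.transferGain adm x<a Exw ¬Hxw (≮⇒≥ w≮b) Hwz (≮⇒≥ a≮z) g
  ...   | inj₂ g′ = augment k adm x<a g′
  ...   | inj₁ g₁ = let H′ , adm′ , less = augment k admissible z<a g₁
                    in H′ , adm′ , <-≤-trans less (≤-reflexive (deficit-≡ (≮⇒≥ a≮z)))
    where
    open Shift adm x<a Exw ¬Hxw (≮⇒≥ w≮b) Hwz
    z<a : deg H₁ z < a
    z<a = subst (_≤ a) (sym deg-z) (≮⇒≥ a≮z)

  -- Closure under the walk rules: a `Gain` walk cannot stop in `T` and steps from there into `S`,
  -- while a `Lose` walk cannot stop in `S` and steps from there into `T`. Hence none of these walks
  -- ever ends.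
  record Barrier (H : Fin N → Fin N → Bool) (S T : Fin N → Bool) : Set where
    field
      T-low  : ∀ {y} → T y ≡ true → deg H y ≤ a
      S-full : ∀ {y} → S y ≡ true → b ≤ deg H y
      T⇒S    : ∀ {y u} → T y ≡ true → E y u ≡ true → H y u ≡ false → S u ≡ true
      S⇒T    : ∀ {y u} → S y ≡ true → H y u ≡ true → T u ≡ true
  open Barrier

  -- A vertex violating a barrier condition either may stop at once or steps to a vertex already
  -- outside, so it has a finite walk and can be removed. The invariant is that every vertex outside
  -- has such a walk; `m` bounds the number of removals.
  saturate : ∀ H m S T → count S + count T < m →
    (∀ y → S y ≡ false → ∃[ k ] Lose H k y) → (∀ y → T y ≡ false → ∃[ k ] Gain H k y) →
    ∃₂ λ S T → Barrier H S T × (∀ y → T y ≡ false → ∃[ k ] Gain H k y)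
  saturate H (suc m) S T (s≤s size) lose gain
    with any? (λ y → T y ≟ᵇ true ×-dec
           (a <? deg H y ⊎-dec any? (λ u → E y u ≟ᵇ true ×-dec H y u ≟ᵇ false ×-dec S u ≟ᵇ false)))
       | any? (λ y → S y ≟ᵇ true ×-dec
           (deg H y <? b ⊎-dec any? (λ u → H y u ≟ᵇ true ×-dec T u ≟ᵇ false)))
  ... | yes (y , Ty , escape) | _ =
    saturate H m S (T ∖ ⁅ y ⁆) (<-≤-trans (+-monoʳ-< (count S) (count-∖ T ⁅ y ⁆ Ty (x∈⁅x⁆ y))) size) lose gain′
    where
    witness : (a < deg H y ⊎ ∃[ u ] E y u ≡ true × H y u ≡ false × S u ≡ false) → ∃[ k ] Gain H k y
    witness (inj₁ a<y) = 0 , stop a<y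
    witness (inj₂ (u , Eyu , ¬Hyu , ¬Su)) = let k , l = lose u ¬Su in suc k , step Eyu ¬Hyu l
    gain′ : ∀ v → (T ∖ ⁅ y ⁆) v ≡ false → ∃[ k ] Gain H k v
    gain′ v r with ∖⁅⁆-false T r
    ... | inj₁ refl = witness escape
    ... | inj₂ ¬Tv = gain v ¬Tv
  ... | no _ | yes (y , Sy , escape) =
    saturate H m (S ∖ ⁅ y ⁆) T (<-≤-trans (+-monoˡ-< (count T) (count-∖ S ⁅ y ⁆ Sy (x∈⁅x⁆ y))) size) lose′ gain
    where
    witness : (deg H y < b ⊎ ∃[ u ] H y u ≡ true × T u ≡ false) → ∃[ k ] Lose H k y
    witness (inj₁ y<b) = 0 , stop y<b
    witness (inj₂ (u , Hyu , ¬Tu)) = let k , g = gain u ¬Tu in suc k , step Hyu g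
    lose′ : ∀ v → (S ∖ ⁅ y ⁆) v ≡ false → ∃[ k ] Lose H k v
    lose′ v r with ∖⁅⁆-false S r
    ... | inj₁ refl = witness escape
    ... | inj₂ ¬Sv = lose v ¬Sv
  ... | no ¬T | no ¬S = S , T , barrier , gain
    where
    barrier : Barrier H S T
    barrier .T-low Ty = ≮⇒≥ λ a<y → ¬T (_ , Ty , inj₁ a<y)
    barrier .S-full Sy = ≮⇒≥ λ y<b → ¬S (_ , Sy , inj₁ y<b)
    barrier .T⇒S {u = u} Ty Eyu ¬Hyu with S u in Su
    ... | true = refl
    ... | false = contradiction (_ , Ty , inj₂ (u , Eyu , ¬Hyu , Su)) ¬T
    barrier .S⇒T {u = u} Sy Hyu with T u in Tu
    ... | true = refl
    ... | false = contradiction (_ , Sy , inj₂ (u , Hyu , Tu)) ¬S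

  module _ {H S T} (adm : Admissible H) (bar : Barrier H S T) where
    private
      cross : Fin N → Fin N → ℕ
      cross y v = ⟦ T v ∧ (S y ∧ H y v) ⟧

      -- A vertex of `S` has at least `b` edges of `H`, and all of them lead into `T`.
      S-cross : ∀ y → b * ⟦ S y ⟧ ≤ ∑ (cross y)
      S-cross y with S y in Sy
      ... | false = ≤-trans (≤-reflexive (*-zeroʳ b)) z≤n
      ... | true = ≤-trans (≤-reflexive (*-identityʳ b)) (≤-trans (S-full bar Sy) (∑-mono into))
        where
        into : ∀ v → ⟦ H y v ⟧ ≤ ⟦ T v ∧ H y v ⟧
        into v with H y v in Hyv
        ... | false = z≤n
        ... | true = ≤-reflexive (cong (λ t → ⟦ t ∧ true ⟧) (sym (S⇒T bar Sy Hyv)))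

      -- Every edge of `E` from `T` to a vertex outside `S` belongs to `H`. Such edges and the
      -- `H`-edges into `S` are disjoint parts of the degree in `H`.
      T-cross : ∀ {y} → T y ≡ true → ∑ (λ v → cross v y) + deg∖ E S y ≤ deg H y
      T-cross {y} Ty = ≤-trans (≤-reflexive (sym (∑-+ (λ v → cross v y) (λ v → ⟦ E y v ∧ not (S v) ⟧)))) (∑-mono split)
        where
        split : ∀ v → cross v y + ⟦ E y v ∧ not (S v) ⟧ ≤ ⟦ H y v ⟧
        split v rewrite Ty | symm adm v y with S v in Sv | E y v in Eyv | H y v in Hyv
        ... | true | true | _ = ≤-reflexive (+-identityʳ _)
        ... | true | false | _ = ≤-reflexive (+-identityʳ _)
        ... | false | false | _ = z≤n
        ... | false | true | true = ≤-refl
        ... | false | true | false with () ← trans (sym Sv) (T⇒S bar Ty Eyv Hyv)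

      T-weight : ∀ y → ∑ (λ v → cross v y) + ⟦ T y ⟧ * deg∖ E S y ≤ a * ⟦ T y ⟧
      T-weight y with T y in Ty
      ... | false = ≤-trans (≤-reflexive (trans (+-identityʳ _) (∑-0 {N}))) z≤n
      ... | true = ≤-trans (≤-reflexive (cong₂ _+_ (∑-cong λ v → cong (λ t → ⟦ t ∧ (S v ∧ H v y) ⟧) (sym Ty)) (*-identityˡ _)))
        (≤-trans (T-cross Ty) (≤-trans (T-low bar Ty) (≤-reflexive (sym (*-identityʳ a)))))

      T-strict : ∀ {y} → T y ≡ true → deg H y < a → ∑ (λ v → cross v y) + ⟦ T y ⟧ * deg∖ E S y < a * ⟦ T y ⟧
      T-strict {y} Ty y<a = ≤-<-trans
        (≤-reflexive (cong (∑ (λ v → cross v y) +_) (trans (cong (λ t → ⟦ t ⟧ * deg∖ E S y) Ty) (*-identityˡ _))))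
        (≤-<-trans (T-cross Ty) (<-≤-trans y<a (≤-reflexive (sym (trans (cong (λ t → a * ⟦ t ⟧) Ty) (*-identityʳ a))))))

    -- The `H`-edges between `S` and `T` are counted from both sides, with at least `b` per vertex
    -- of `S` and at most `a` minus the outer degree per vertex of `T`. The short vertex `x` makes
    -- the inequality strict.
    barrier⇒deficient : ∀ {x} → T x ≡ true → deg H x < a → Deficient E a b S T
    barrier⇒deficient {x} Tx x<a = disjoint , (begin-strict
      b * count S + ∑ outer                          ≡⟨ cong (_+ ∑ outer) (∑-*ˡ b (⟦_⟧ ∘ S)) ⟨
      ∑ (λ y → b * ⟦ S y ⟧) + ∑ outer                ≤⟨ +-monoˡ-≤ (∑ outer) (∑-mono S-cross) ⟩
      ∑ (λ y → ∑ (cross y)) + ∑ outer                ≡⟨ cong (_+ ∑ outer) (∑-swap cross) ⟩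
      ∑ (λ y → ∑ (λ v → cross v y)) + ∑ outer        ≡⟨ ∑-+ (λ y → ∑ (λ v → cross v y)) outer ⟨
      ∑ (λ y → ∑ (λ v → cross v y) + outer y)        <⟨ ∑-mono-< T-weight x (T-strict Tx x<a) ⟩
      ∑ (λ y → a * ⟦ T y ⟧)                          ≡⟨ ∑-*ˡ a (⟦_⟧ ∘ T) ⟩
      a * count T                                    ∎)
      where
      open ≤-Reasoning
      outer : Fin N → ℕ
      outer y = ⟦ T y ⟧ * deg∖ E S y
      disjoint : ∀ y → T y ≡ true → S y ≡ false
      disjoint y Ty = ¬-not λ Sy → <⇒≱ a<b (≤-trans (S-full bar Sy) (T-low bar Ty))

  improve : ∀ m H → Admissible H → deficit H < m → HasFactor E a b ⊎ ∃₂ (Deficient E a b)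
  improve (suc m) H adm (s≤s size) with any? (λ x → deg H x <? a)
  ... | no ¬low = inj₁ (H , symm adm , sub adm , λ x → ≮⇒≥ (λ x<a → ¬low (x , x<a)) , bound adm x)
  -- Starting from all vertices makes both invariants vacuous.
  ... | yes (x , x<a) with saturate H _ (λ _ → true) (λ _ → true) ≤-refl (λ _ ()) (λ _ ())
  ...   | S , T , bar , gain with T x in Tx
  ...     | true = inj₂ (S , T , barrier⇒deficient adm bar Tx x<a)
  ...     | false = let H′ , adm′ , less = augment _ adm x<a (proj₂ (gain x Tx))
                    in improve m H′ adm′ (<-≤-trans less size)

  factor-or-deficient : HasFactor E a b ⊎ ∃₂ (Deficient E a b)
  factor-or-deficient = improve _ (λ _ _ → false) empty ≤-refl
    where
    empty : Admissible (λ _ _ → false)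
    empty .symm _ _ = refl
    empty .sub _ _ ()
    empty .bound _ = ≤-trans (≤-reflexive (∑-0 {N})) z≤n

-- Greedy choice of an independent set.

minimiser : ∀ (P : Fin N → Bool) (f : Fin N → ℕ) m {x} → P x ≡ true → f x < m →
  ∃[ x ] P x ≡ true × (∀ y → P y ≡ true → f x ≤ f y)
minimiser P f (suc m) {x} Px (s≤s fx≤m) with any? (λ y → P y ≟ᵇ true ×-dec f y <? f x)
... | yes (y , Py , fy<fx) = minimiser P f m Py (<-≤-trans fy<fx fx≤m)
... | no none = x , Px , λ y Py → ≮⇒≥ λ fy<fx → none (y , Py , fy<fx)

module Greedy {N} (E : Fin N → Fin N → Bool) (E-sym : Symmetric E) (E-irrefl : ∀ v → E v v ≡ false)
              (S : Fin N → Bool) (a : ℕ) where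

  -- `cost v` bounds the total gap in the closed neighbourhood of `v` outside `S`, when `v` has the
  -- least `d` there: at most `suc (d v)` vertices, each with gap at most `gap v`.
  d gap cost : Fin N → ℕ
  d = deg∖ E S
  gap v = a ∸ d v
  cost v = suc (d v) * gap v

  record Independent (U I : Fin N → Bool) : Set where
    field
      within   : ∀ {v} → I v ≡ true → U v ≡ true
      low      : ∀ {v} → I v ≡ true → d v < a
      isolated : ∀ {u v} → I u ≡ true → I v ≡ true → E u v ≡ false
  open Independent

  near : Fin N → Fin N → Bool
  near x v = ⁅ x ⁆ v ∨ E x v

  x∈near : ∀ x → near x x ≡ true
  x∈near x = cong (_∨ E x x) (x∈⁅x⁆ x)

  near-false : ∀ {x v} → near x v ≡ false → x ≢ v × E x v ≡ false
  near-false {x} {v} r with x ≟ v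
  ... | no x≢v = x≢v , r

  ∪-elim : ∀ {x v} (I : Fin N → Bool) → ⁅ x ⁆ v ∨ I v ≡ true → x ≡ v ⊎ I v ≡ true
  ∪-elim {x} {v} I r with x ≟ v
  ... | yes x≡v = inj₁ x≡v
  ... | no _ = inj₂ r

  -- One greedy step. The vertices of `U` near `x` are charged to `cost x`, the others to `I` by
  -- induction; `I` avoids the closed neighbourhood of `x`, so adding `x` keeps it independent.
  module Extend {U x} (U∩S=∅ : ∀ {v} → U v ≡ true → S v ≡ false) (Ux : U x ≡ true) (x<a : d x < a)
                (minimal : ∀ v → U v ≡ true → d x ≤ d v)
                {I} (ind : Independent (U ∖ near x) I) where
    I⁺ : Fin N → Bool
    I⁺ v = ⁅ x ⁆ v ∨ I v

    private
      far : ∀ {v} → I v ≡ true → x ≢ v × E x v ≡ false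
      far Iv = near-false (proj₂ (∖-elim U (near x) (within ind Iv)))

    independent : Independent U I⁺
    independent .within Iv with ∪-elim I Iv
    ... | inj₁ refl = Ux
    ... | inj₂ Iv = proj₁ (∖-elim U (near x) (within ind Iv))
    independent .low Iv with ∪-elim I Iv
    ... | inj₁ refl = x<a
    ... | inj₂ Iv = low ind Iv
    independent .isolated {u} {v} Iu Iv with ∪-elim I Iu | ∪-elim I Iv
    ... | inj₁ refl | inj₁ refl = E-irrefl x
    ... | inj₁ refl | inj₂ Iv = proj₂ (far Iv)
    ... | inj₂ Iu | inj₁ refl = trans (E-sym u x) (proj₂ (far Iu))
    ... | inj₂ Iu | inj₂ Iv = isolated ind Iu Iv

    near-count : count (λ v → U v ∧ near x v) ≤ suc (d x)
    near-count = ≤-trans (∑-mono counted)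
      (≤-reflexive (trans (∑-+ (δ x) (⟦_⟧ ∘ (E x ∖ S))) (cong (_+ d x) (∑-δ x))))
      where
      counted : ∀ v → ⟦ U v ∧ near x v ⟧ ≤ δ x v + ⟦ (E x ∖ S) v ⟧
      counted v with U v in Uv
      ... | false = z≤n
      ... | true = ≤-trans (⟦∨⟧≤ ⌊ x ≟ v ⌋ (E x v))
        (+-monoʳ-≤ (δ x v) (≤-reflexive (cong ⟦_⟧ (sym (trans (cong (λ s → E x v ∧ not s) (U∩S=∅ Uv)) (∧-identityʳ _))))))

    module _ (ih : ∑ (λ v → ⟦ (U ∖ near x) v ⟧ * gap v) ≤ ∑ (λ v → ⟦ I v ⟧ * cost v)) where
      weight : ∑ (λ v → ⟦ U v ⟧ * gap v) ≤ ∑ (λ v → ⟦ I⁺ v ⟧ * cost v)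
      weight = begin
        ∑ (λ v → ⟦ U v ⟧ * gap v)                            ≤⟨ ∑-mono near-or-far ⟩
        ∑ (λ v → gap x * ⟦ U v ∧ near x v ⟧ + far-gap v)     ≡⟨ ∑-+ (λ v → gap x * ⟦ U v ∧ near x v ⟧) far-gap ⟩
        ∑ (λ v → gap x * ⟦ U v ∧ near x v ⟧) + ∑ far-gap     ≡⟨ cong (_+ ∑ far-gap) (∑-*ˡ (gap x) (λ v → ⟦ U v ∧ near x v ⟧)) ⟩
        gap x * count (λ v → U v ∧ near x v) + ∑ far-gap     ≤⟨ +-mono-≤ (*-monoʳ-≤ (gap x) near-count) ih ⟩
        gap x * suc (d x) + ∑ I-cost                         ≡⟨ cong (_+ ∑ I-cost) (*-comm (gap x) (suc (d x))) ⟩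
        cost x + ∑ I-cost                                    ≡⟨ cong (_+ ∑ I-cost) (∑-δ* x cost) ⟨
        ∑ (λ v → δ x v * cost v) + ∑ I-cost                  ≡⟨ ∑-+ (λ v → δ x v * cost v) I-cost ⟨
        ∑ (λ v → δ x v * cost v + I-cost v)                  ≡⟨ ∑-cong disjoint ⟩
        ∑ (λ v → ⟦ I⁺ v ⟧ * cost v)                          ∎
        where
        open ≤-Reasoning
        far-gap I-cost : Fin N → ℕ
        far-gap v = ⟦ (U ∖ near x) v ⟧ * gap v
        I-cost v = ⟦ I v ⟧ * cost v

        near-or-far : ∀ v → ⟦ U v ⟧ * gap v ≤ gap x * ⟦ U v ∧ near x v ⟧ + far-gap v
        near-or-far v with U v in Uv | near x v
        ... | false | _ = z≤n
        ... | true | true = begin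
          gap v + 0              ≡⟨ +-identityʳ (gap v) ⟩
          gap v                  ≤⟨ ∸-monoʳ-≤ a (minimal v Uv) ⟩
          gap x                  ≡⟨ *-identityʳ (gap x) ⟨
          gap x * 1              ≡⟨ +-identityʳ _ ⟨
          gap x * 1 + 0          ∎
        ... | true | false = m≤n+m _ (gap x * 0)

        disjoint : ∀ v → δ x v * cost v + I-cost v ≡ ⟦ I⁺ v ⟧ * cost v
        disjoint v = trans (sym (*-distribʳ-+ (cost v) (δ x v) ⟦ I v ⟧))
          (cong (_* cost v) (sym (⟦∨⟧-disjoint ⌊ x ≟ v ⌋ (I v) λ Iv → ¬-not λ x≡v → proj₁ (far Iv) (∈⁅⁆⇒≡ x≡v))))

  -- Vertices with `d` at least `a` have gap zero, so the choice may end when no lower one remains.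
  -- Otherwise the low vertex `y` only certifies that the minimiser `x` is low, and removing
  -- `near x` shrinks `U` because it contains `x`.
  greedy : ∀ m U → count U < m → (∀ {v} → U v ≡ true → S v ≡ false) →
    ∃[ I ] Independent U I × ∑ (λ v → ⟦ U v ⟧ * gap v) ≤ ∑ (λ v → ⟦ I v ⟧ * cost v)
  greedy (suc m) U (s≤s size) U∩S=∅ with any? (λ x → U x ≟ᵇ true ×-dec d x <? a)
  ... | no none = (λ _ → false) , record { within = λ () ; low = λ () ; isolated = λ () } , ∑-mono vanishing
    where
    vanishing : ∀ v → ⟦ U v ⟧ * gap v ≤ 0
    vanishing v with U v in Uv
    ... | false = z≤n
    ... | true = ≤-reflexive (trans (+-identityʳ _) (m≤n⇒m∸n≡0 (≮⇒≥ λ v<a → none (v , Uv , v<a))))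
  ... | yes (y , Uy , y<a) with minimiser U d _ Uy ≤-refl
  ...   | x , Ux , minimal =
    let I , ind , ih = greedy m (U ∖ near x) (<-≤-trans (count-∖ U (near x) Ux (x∈near x)) size)
                         (λ Uv → U∩S=∅ (proj₁ (∖-elim U (near x) Uv)))
        open Extend {U} {x} U∩S=∅ Ux (≤-<-trans (minimal y Uy) y<a) minimal {I} ind
    in I⁺ , independent , weight ih

-- Degrees lost with the matching.

∑-occurrences : (xs : List (Fin N)) → ∑ (λ u → occurrences u xs) ≡ length xs
∑-occurrences {N} [] = ∑-0 {N}
∑-occurrences (x ∷ xs) = trans (∑-+ (δ x) (λ u → occurrences u xs)) (cong₂ _+_ (∑-δ x) (∑-occurrences xs))

length-endpoints : (M : List (Fin N × Fin N)) → length (endpoints M) ≡ 2 * length M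
length-endpoints [] = refl
length-endpoints (_ ∷ M) = trans (cong (suc ∘ suc) (length-endpoints M)) (sym (*-suc 2 (length M)))

-- Membership in a nonempty list unfolds to `link` or membership in the tail. Endpoint occurrences
-- give both bounds used later: twice the length in total, and at most one at each vertex of a
-- matching.
deg-inM : ∀ (M : List (Fin N × Fin N)) u → deg (inM M) u ≤ occurrences u (endpoints M)
deg-inM {N} [] u = ≤-reflexive (∑-0 {N})
deg-inM ((x , w) ∷ M) u = begin
  deg (inM ((x , w) ∷ M)) u                              ≤⟨ ∑-mono (λ v → ⟦∨⟧≤ (link x w u v) (inM M u v)) ⟩
  ∑ (λ v → ⟦ link x w u v ⟧ + ⟦ inM M u v ⟧)             ≡⟨ ∑-+ (⟦_⟧ ∘ link x w u) (⟦_⟧ ∘ inM M u) ⟩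
  deg (link x w) u + deg (inM M) u                       ≤⟨ +-mono-≤ (deg-link≤ x w u) (deg-inM M u) ⟩
  δ x u + δ w u + occurrences u (endpoints M)            ≡⟨ +-assoc (δ x u) _ _ ⟩
  δ x u + (δ w u + occurrences u (endpoints M))          ∎
  where open ≤-Reasoning

inM-sym : (M : List (Fin N × Fin N)) → Symmetric (inM M)
inM-sym [] u v = refl
inM-sym ((x , w) ∷ M) u v = cong₂ _∨_ (link-sym x w u v) (inM-sym M u v)

minusEdges-sym : (G : Graph N) (M : List (Fin N × Fin N)) → Symmetric (minusEdges G M)
minusEdges-sym G M u v = cong₂ (λ p q → p ∧ not q) (adj-sym G u v) (inM-sym M u v)

minusEdges-irrefl : (G : Graph N) (M : List (Fin N × Fin N)) → ∀ v → minusEdges G M v v ≡ false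
minusEdges-irrefl G M v = cong (_∧ not (inM M v v)) (adj-irrefl G v)

deg∖-minusEdges : ∀ (G : Graph N) M S u → deg∖ (adj G) S u ≤ deg∖ (minusEdges G M) S u + deg (inM M) u
deg∖-minusEdges G M S u = ≤-trans (∑-mono kept-or-deleted)
  (≤-reflexive (∑-+ (⟦_⟧ ∘ (minusEdges G M u ∖ S)) (⟦_⟧ ∘ inM M u)))
  where
  kept-or-deleted : ∀ v → ⟦ (adj G u ∖ S) v ⟧ ≤ ⟦ (minusEdges G M u ∖ S) v ⟧ + ⟦ inM M u v ⟧
  kept-or-deleted v with adj G u v | S v | inM M u v
  ... | false | _ | _ = z≤n
  ... | true | true | _ = z≤n
  ... | true | false | true = ≤-refl
  ... | true | false | false = ≤-refl

all-true : (p : A → Bool) → (∀ x → p x ≡ true) → ∀ xs → all p xs ≡ true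
all-true p p-true [] = refl
all-true p p-true (x ∷ xs) = cong₂ _∧_ (p-true x) (all-true p p-true xs)

-- Isolating an independent set.

module Toughness {N} (G : Graph N) (S : Fin N → Bool) (a : ℕ) where
  open Greedy (adj G) (adj-sym G) (adj-irrefl G) S a
  open Independent

  independent⇒¬Complete : ∀ {U I} → Independent U I → ∀ {x y} → I x ≡ true → I y ≡ true → x ≢ y → ¬ Complete G
  independent⇒¬Complete ind Ix Iy x≢y complete with () ← trans (sym (complete _ _ x≢y)) (isolated ind Ix Iy)

  two-members : ∀ {I : Fin N → Bool} {x y} → I x ≡ true → I y ≡ true → x ≢ y → 2 ≤ count I
  two-members {I} {x} {y} Ix Iy x≢y = ≤-trans
    (≤-reflexive (sym (trans (∑-+ (δ x) (δ y)) (cong₂ _+_ (∑-δ x) (∑-δ y))))) (∑-mono members)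
    where
    members : ∀ v → δ x v + δ y v ≤ ⟦ I v ⟧
    members v with x ≟ v | y ≟ v
    ... | yes refl | yes refl = contradiction refl x≢y
    ... | yes refl | no _ = ≤-reflexive (cong ⟦_⟧ (sym Ix))
    ... | no _ | yes refl = ≤-reflexive (cong ⟦_⟧ (sym Iy))
    ... | no _ | no _ = z≤n

  S∪N[_] : (Fin N → Bool) → Fin N → Bool
  S∪N[ I ] v = S v ∨ ⌊ any? (λ u → I u ∧ adj G u v ≟ᵇ true) ⌋

  -- A union bound: each vertex added to `S` is a neighbour outside `S` of some member of `I`.
  count-S∪N : ∀ I → count S∪N[ I ] ≤ count S + ∑ (λ v → ⟦ I v ⟧ * d v)
  count-S∪N I = begin
    count S∪N[ I ]                                                 ≤⟨ ∑-mono covered ⟩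
    ∑ (λ v → ⟦ S v ⟧ + ∑ (λ u → ⟦ I u ⟧ * ⟦ (adj G u ∖ S) v ⟧))    ≡⟨ ∑-+ (⟦_⟧ ∘ S) (λ v → ∑ (λ u → ⟦ I u ⟧ * ⟦ (adj G u ∖ S) v ⟧)) ⟩
    count S + ∑ (λ v → ∑ (λ u → ⟦ I u ⟧ * ⟦ (adj G u ∖ S) v ⟧))    ≡⟨ cong (count S +_) (∑-swap (λ v u → ⟦ I u ⟧ * ⟦ (adj G u ∖ S) v ⟧)) ⟩
    count S + ∑ (λ u → ∑ (λ v → ⟦ I u ⟧ * ⟦ (adj G u ∖ S) v ⟧))    ≡⟨ cong (count S +_) (∑-cong λ u → ∑-*ˡ ⟦ I u ⟧ (⟦_⟧ ∘ (adj G u ∖ S))) ⟩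
    count S + ∑ (λ u → ⟦ I u ⟧ * d u)                              ∎
    where
    open ≤-Reasoning
    covered : ∀ v → ⟦ S∪N[ I ] v ⟧ ≤ ⟦ S v ⟧ + ∑ (λ u → ⟦ I u ⟧ * ⟦ (adj G u ∖ S) v ⟧)
    covered v with S v | any? (λ u → I u ∧ adj G u v ≟ᵇ true)
    ... | true | _ = s≤s z≤n
    ... | false | no _ = z≤n
    ... | false | yes (u , IuEuv) = ≤-trans (≤-reflexive (sym edge)) (term≤∑ (λ u → ⟦ I u ⟧ * ⟦ adj G u v ∧ true ⟧) u)
      where
      edge : ⟦ I u ⟧ * ⟦ adj G u v ∧ true ⟧ ≡ 1
      edge with I u | adj G u v
      ... | true | true = refl

  -- Independence keeps the members of `I` out of `N(I)`, and lying in `U` keeps them out of `S`, so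
  -- they survive the deletion while all their neighbours are deleted.
  count≤iso : ∀ {U I} → (∀ {v} → U v ≡ true → S v ≡ false) → Independent U I → count I ≤ iso G S∪N[ I ]
  count≤iso {I = I} U∩S=∅ ind = ∑-mono becomes-isolated
    where
    outside : ∀ {v} → I v ≡ true → S∪N[ I ] v ≡ false
    outside {v} Iv rewrite U∩S=∅ (within ind Iv) with any? (λ u → I u ∧ adj G u v ≟ᵇ true)
    ... | no _ = refl
    ... | yes (u , IuEuv) with I u in Iu
    ...   | true with () ← trans (sym IuEuv) (isolated ind Iu Iv)
    neighbours : ∀ {v} → I v ≡ true → ∀ u → not (adj G v u) ∨ S∪N[ I ] u ≡ true
    neighbours {v} Iv u with adj G v u in Evu | S u | any? (λ w → I w ∧ adj G w u ≟ᵇ true)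
    ... | false | _ | _ = refl
    ... | true | true | _ = refl
    ... | true | false | yes _ = refl
    ... | true | false | no none = contradiction (v , cong₂ _∧_ Iv Evu) none
    becomes-isolated : ∀ v → ⟦ I v ⟧ ≤ ⟦ isolatedIn G S∪N[ I ] v ⟧
    becomes-isolated v with I v in Iv
    ... | false = z≤n
    ... | true = ≤-reflexive (cong ⟦_⟧ (sym (cong₂ _∧_ (cong not (outside Iv)) (all-true _ (neighbours Iv) (allFin N)))))

-- Contradiction from a deficient pair.

-- With `a` written as `d + e`, the right side exceeds the left by `(b - d) * e`.
cost-bound : ∀ {a b d} → suc a < b → d < suc a → suc d * (suc a ∸ d) + b * d ≤ suc a + b * a
cost-bound {b = b} {d} a<b (s≤s d≤a) with e , refl ← m≤n⇒∃[o]m+o≡n d≤a = begin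
  suc d * (suc (d + e) ∸ d) + b * d      ≡⟨ cong (λ g → suc d * (g ∸ d) + b * d) (+-suc d e) ⟨
  suc d * (d + suc e ∸ d) + b * d        ≡⟨ cong (λ g → suc d * g + b * d) (m+n∸m≡n d (suc e)) ⟩
  suc d * suc e + b * d                  ≡⟨ expand b d e ⟩
  suc (d + e) + b * d + d * e            ≤⟨ +-monoʳ-≤ (suc (d + e) + b * d) (*-monoˡ-≤ e d≤b) ⟩
  suc (d + e) + b * d + b * e            ≡⟨ collect b d e ⟩
  suc (d + e) + b * (d + e)              ∎
  where
  open ≤-Reasoning
  d≤b : d ≤ b
  d≤b = ≤-trans (m≤m+n d e) (≤-trans (n≤1+n _) (<⇒≤ a<b))
  expand : ∀ b d e → suc d * suc e + b * d ≡ suc (d + e) + b * d + d * e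
  expand = solve-∀
  collect : ∀ b d e → suc (d + e) + b * d + b * e ≡ suc (d + e) + b * (d + e)
  collect = solve-∀

-- The degree bound is `suc a` and the matching has `suc n` edges, so that the numerator of the
-- toughness bound contains no truncated subtraction.
module NoDeficientPair (a b n : ℕ) {N} (a<b : suc a < b) (G : Graph N) (δ≥ : MinDegreeAtLeast G (suc a + suc n))
                       (tough : IsoToughnessAtLeast G (a * b + (a + 2 * suc n)) b)
                       (M : List (Fin N × Fin N)) (unique : Unique (endpoints M)) (∣M∣ : length M ≡ suc n)
                       {S T : Fin N → Bool} (deficient : Deficient (minusEdges G M) (suc a) b S T) where
  open Greedy (adj G) (adj-sym G) (adj-irrefl G) S (suc a)
  open Toughness G S (suc a)
  open Independent
  open ≤-Reasoning

  d′ : Fin N → ℕ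
  d′ = deg∖ (minusEdges G M) S

  T∩S=∅ : ∀ {v} → T v ≡ true → S v ≡ false
  T∩S=∅ = proj₁ deficient _

  ∑-deg-inM : ∑ (deg (inM M)) ≤ 2 * suc n
  ∑-deg-inM = begin
    ∑ (deg (inM M))                              ≤⟨ ∑-mono (deg-inM M) ⟩
    ∑ (λ u → occurrences u (endpoints M))        ≡⟨ ∑-occurrences (endpoints M) ⟩
    length (endpoints M)                         ≡⟨ length-endpoints M ⟩
    2 * length M                                 ≡⟨ cong (2 *_) ∣M∣ ⟩
    2 * suc n                                    ∎

  T-gap T-d′ : Fin N → ℕ
  T-gap v = ⟦ T v ⟧ * gap v
  T-d′ v = ⟦ T v ⟧ * d′ v

  T-bound : ∀ v → suc a * ⟦ T v ⟧ ≤ T-gap v + deg (inM M) v + T-d′ v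
  T-bound v with T v
  ... | false = ≤-trans (≤-reflexive (*-zeroʳ (suc a))) z≤n
  ... | true = begin
    suc a * 1                                    ≡⟨ *-identityʳ (suc a) ⟩
    suc a                                        ≤⟨ m≤n+m∸n (suc a) (d v) ⟩
    d v + gap v                                  ≤⟨ +-monoˡ-≤ (gap v) (deg∖-minusEdges G M S v) ⟩
    d′ v + deg (inM M) v + gap v                 ≡⟨ rearrange (d′ v) (deg (inM M) v) (gap v) ⟩
    1 * gap v + deg (inM M) v + 1 * d′ v         ∎
    where
    rearrange : ∀ x y z → x + y + z ≡ 1 * z + y + 1 * x
    rearrange = solve-∀

  S-bound : b * count S < ∑ T-gap + 2 * suc n
  S-bound = +-cancelʳ-< (∑ T-d′) _ _ (begin-strict
    b * count S + ∑ T-d′                                       <⟨ proj₂ deficient ⟩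
    suc a * count T                                            ≡⟨ ∑-*ˡ (suc a) (⟦_⟧ ∘ T) ⟨
    ∑ (λ v → suc a * ⟦ T v ⟧)                                  ≤⟨ ∑-mono T-bound ⟩
    ∑ (λ v → T-gap v + deg (inM M) v + T-d′ v)                 ≡⟨ ∑-+ (λ v → T-gap v + deg (inM M) v) T-d′ ⟩
    ∑ (λ v → T-gap v + deg (inM M) v) + ∑ T-d′                 ≡⟨ cong (_+ ∑ T-d′) (∑-+ T-gap (deg (inM M))) ⟩
    ∑ T-gap + ∑ (deg (inM M)) + ∑ T-d′                         ≤⟨ +-monoˡ-≤ (∑ T-d′) (+-monoʳ-≤ (∑ T-gap) ∑-deg-inM) ⟩
    ∑ T-gap + 2 * suc n + ∑ T-d′                               ∎)

  -- Were all `d′` on `T` at least `suc a`, the pair would not be deficient. Restoring the matching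
  -- adds at most one to the degree of a vertex, hence `suc a` and not `a`.
  some-low : ∃[ x ] d x ≤ suc a
  some-low with any? (λ x → T x ≟ᵇ true ×-dec d′ x <? suc a)
  ... | yes (x , _ , d′<a) = x , (begin
    d x                                          ≤⟨ deg∖-minusEdges G M S x ⟩
    d′ x + deg (inM M) x                         ≤⟨ +-mono-≤ (≤-pred d′<a) (≤-trans (deg-inM M x) (occurrences-unique x unique)) ⟩
    a + 1                                        ≡⟨ +-comm a 1 ⟩
    suc a                                        ∎)
  ... | no none = contradiction (proj₂ deficient) (≤⇒≯ (begin
    suc a * count T                              ≡⟨ ∑-*ˡ (suc a) (⟦_⟧ ∘ T) ⟨
    ∑ (λ v → suc a * ⟦ T v ⟧)                    ≤⟨ ∑-mono high ⟩
    ∑ T-d′                                       ≤⟨ m≤n+m _ (b * count S) ⟩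
    b * count S + ∑ T-d′                         ∎))
    where
    high : ∀ v → suc a * ⟦ T v ⟧ ≤ ⟦ T v ⟧ * d′ v
    high v with T v in Tv
    ... | false = ≤-reflexive (*-zeroʳ (suc a))
    ... | true = begin
      suc a * 1        ≡⟨ *-identityʳ (suc a) ⟩
      suc a            ≤⟨ ≮⇒≥ (λ low → none (v , Tv , low)) ⟩
      d′ v             ≡⟨ +-identityʳ (d′ v) ⟨
      d′ v + 0         ∎

  -- The minimum degree forces `S` to have at least `gap x + suc n` vertices. As `b` is at least
  -- `suc (d x)` and at least 2, `b * count S` then covers both `cost x` and `2 * suc n`, against
  -- `S-bound`.
  ¬gap-small : ∀ x → d x ≤ suc a → ¬ ∑ T-gap ≤ cost x
  ¬gap-small x d≤a W≤cost = <⇒≱ S-bound (begin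
    ∑ T-gap + 2 * suc n                          ≤⟨ +-mono-≤ W≤cost (*-monoˡ-≤ (suc n) (≤-trans (s≤s (s≤s z≤n)) a<b)) ⟩
    suc (d x) * gap x + b * suc n                ≤⟨ +-monoˡ-≤ (b * suc n) (*-monoˡ-≤ (gap x) (≤-<-trans d≤a a<b)) ⟩
    b * gap x + b * suc n                        ≡⟨ *-distribˡ-+ b (gap x) (suc n) ⟨
    b * (gap x + suc n)                          ≤⟨ *-monoʳ-≤ b S-large ⟩
    b * count S                                  ∎)
    where
    S-large : gap x + suc n ≤ count S
    S-large = +-cancelˡ-≤ (d x) _ _ (begin
      d x + (gap x + suc n)                      ≡⟨ +-assoc (d x) (gap x) (suc n) ⟨
      d x + gap x + suc n                        ≡⟨ cong (_+ suc n) (m+[n∸m]≡n d≤a) ⟩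
      suc a + suc n                              ≤⟨ δ≥ x ⟩
      deg (adj G) x                              ≤⟨ count≤count∖+count (adj G x) S ⟩
      d x + count S                              ∎)

  module _ {I} (ind : Independent T I) (W≤cost : ∑ T-gap ≤ ∑ (λ v → ⟦ I v ⟧ * cost v)) where
    I-cost I-d : Fin N → ℕ
    I-cost v = ⟦ I v ⟧ * cost v
    I-d v = ⟦ I v ⟧ * d v

    -- The first sum pays for `S` through `S-bound`, the second for the neighbours of `I`.
    I-bound : ∑ I-cost + b * ∑ I-d ≤ (suc a + b * a) * count I
    I-bound = begin
      ∑ I-cost + b * ∑ I-d                       ≡⟨ cong (∑ I-cost +_) (∑-*ˡ b I-d) ⟨
      ∑ I-cost + ∑ (λ v → b * I-d v)             ≡⟨ ∑-+ I-cost (λ v → b * I-d v) ⟨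
      ∑ (λ v → I-cost v + b * I-d v)             ≤⟨ ∑-mono bounded ⟩
      ∑ (λ v → (suc a + b * a) * ⟦ I v ⟧)        ≡⟨ ∑-*ˡ (suc a + b * a) (⟦_⟧ ∘ I) ⟩
      (suc a + b * a) * count I                  ∎
      where
      bounded : ∀ v → I-cost v + b * I-d v ≤ (suc a + b * a) * ⟦ I v ⟧
      bounded v with I v in Iv
      ... | false = ≤-trans (≤-reflexive (*-zeroʳ b)) z≤n
      ... | true = begin
        1 * cost v + b * (1 * d v)               ≡⟨ cong₂ (λ x y → x + b * y) (*-identityˡ (cost v)) (*-identityˡ (d v)) ⟩
        cost v + b * d v                         ≤⟨ cost-bound a<b (low ind Iv) ⟩
        suc a + b * a                            ≡⟨ *-identityʳ _ ⟨
        (suc a + b * a) * 1                      ∎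

    -- b I(G) exceeds the bound suc a + b * a for the cost of one vertex by 2n - 1, so two
    -- independent vertices already absorb the 2n lost with the edges of M.
    ¬two : ∀ {x y} → I x ≡ true → I y ≡ true → x ≢ y → ⊥
    ¬two Ix Iy x≢y = <⇒≱ upper (begin
      2 * suc n                                  ≤⟨ m≤n+m _ (2 * n) ⟩
      2 * n + 2 * suc n                          ≡⟨ double n ⟩
      suc (2 * n) * 2                            ≤⟨ *-monoʳ-≤ (suc (2 * n)) two ⟩
      suc (2 * n) * count I                      ∎)
      where
      two : 2 ≤ count I
      two = two-members Ix Iy x≢y

      count≤ : count I ≤ iso G S∪N[ I ]
      count≤ = count≤iso T∩S=∅ ind

      double : ∀ n → 2 * n + 2 * suc n ≡ suc (2 * n) * 2
      double = solve-∀

      split : ∀ a b n i → suc (2 * n) * i + (suc a + b * a) * i ≡ (a * b + (a + 2 * suc n)) * i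
      split = solve-∀

      regroup : ∀ w m x → w + m + x ≡ m + (w + x)
      regroup = solve-∀

      upper : suc (2 * n) * count I < 2 * suc n
      upper = +-cancelʳ-< ((suc a + b * a) * count I) _ _ (begin-strict
        suc (2 * n) * count I + (suc a + b * a) * count I      ≡⟨ split a b n (count I) ⟩
        (a * b + (a + 2 * suc n)) * count I                    ≤⟨ *-monoʳ-≤ (a * b + (a + 2 * suc n)) count≤ ⟩
        -- Distinct members of `I` are nonadjacent, so `G` is not complete and the quotient form of
        -- isolated toughness applies.
        (a * b + (a + 2 * suc n)) * iso G S∪N[ I ]             ≤⟨ proj₂ tough (independent⇒¬Complete ind Ix Iy x≢y) S∪N[ I ] (≤-trans two count≤) ⟩
        b * count S∪N[ I ]                                     ≤⟨ *-monoʳ-≤ b (count-S∪N I) ⟩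
        b * (count S + ∑ I-d)                                  ≡⟨ *-distribˡ-+ b (count S) (∑ I-d) ⟩
        b * count S + b * ∑ I-d                                <⟨ +-monoˡ-< (b * ∑ I-d) S-bound ⟩
        ∑ T-gap + 2 * suc n + b * ∑ I-d                        ≤⟨ +-monoˡ-≤ (b * ∑ I-d) (+-monoˡ-≤ (2 * suc n) W≤cost) ⟩
        ∑ I-cost + 2 * suc n + b * ∑ I-d                       ≡⟨ regroup (∑ I-cost) (2 * suc n) (b * ∑ I-d) ⟩
        2 * suc n + (∑ I-cost + b * ∑ I-d)                     ≤⟨ +-monoʳ-≤ (2 * suc n) I-bound ⟩
        2 * suc n + (suc a + b * a) * count I                  ∎)

    impossible : ⊥
    impossible with any? (λ x → I x ≟ᵇ true)
    -- With `I` empty the total gap is zero, so any vertex with `d` at most `suc a` yields the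
    -- contradiction.
    ... | no empty = let x , d≤a = some-low in ¬gap-small x d≤a (begin
      ∑ T-gap            ≤⟨ W≤cost ⟩
      ∑ I-cost           ≤⟨ ∑-mono vanishing ⟩
      ∑ {N} (λ _ → 0)    ≡⟨ ∑-0 {N} ⟩
      0                  ≤⟨ z≤n ⟩
      cost x             ∎)
      where
      vanishing : ∀ v → I-cost v ≤ 0
      vanishing v with I v in Iv
      ... | false = z≤n
      ... | true = contradiction (v , Iv) empty
    ... | yes (x , Ix) with any? (λ y → I y ≟ᵇ true ×-dec ¬? (x ≟ y))
    ...   | yes (y , Iy , x≢y) = ¬two Ix Iy x≢y
    -- `I` is the single vertex `x`, so the total cost collapses to `cost x`.
    ...   | no single = ¬gap-small x (<⇒≤ (low ind Ix)) (begin
      ∑ T-gap                      ≤⟨ W≤cost ⟩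
      ∑ I-cost                     ≤⟨ ∑-mono (λ v → *-monoˡ-≤ (cost v) (only v)) ⟩
      ∑ (λ v → δ x v * cost v)     ≡⟨ ∑-δ* x cost ⟩
      cost x                       ∎)
      where
      only : ∀ v → ⟦ I v ⟧ ≤ δ x v
      only v with I v in Iv | x ≟ v
      ... | false | _ = z≤n
      ... | true | yes _ = ≤-refl
      ... | true | no x≢v = contradiction (v , Iv , x≢v) single

  absurd : ⊥
  absurd = let _ , ind , W≤cost = greedy _ T ≤-refl T∩S=∅ in impossible ind W≤cost

theorem6 : ∀ (a b n N : ℕ) → 1 ≤ a → a < b → 1 ≤ n → (G : Graph N) →
    MinDegreeAtLeast G (a + n) →
    IsoToughnessAtLeast G ((a ∸ 1) * b + (a + 2 * n ∸ 1)) b →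
    ∀ (M : List (Fin N × Fin N)) → IsMatching G M → length M ≡ n →
    HasFactor (minusEdges G M) a b
theorem6 (suc a) b (suc n) N _ a<b _ G δ≥ tough M (_ , unique) ∣M∣
  with AlternatingWalks.factor-or-deficient (minusEdges G M) (minusEdges-sym G M) (minusEdges-irrefl G M) (suc a) b a<b
... | inj₁ factor = factor
... | inj₂ (_ , _ , deficient) = ⊥-elim (NoDeficientPair.absurd a b n a<b G δ≥ tough M unique ∣M∣ deficient)
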